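{- For all integers $n,k$ with $n\geq k\geq 2$, there are at least $k-1$ prime numbers $p$ with $n<p<kn$. -}

module Defs where

open import Data.List.Base using (length)
open import Data.List.Relation.Unary.All using (All)
open import Data.List.Relation.Unary.Unique.Propositional using (Unique)
open import Data.Nat.Base using (ℕ; _≤_)
open import Data.Product.Base using (∃-syntax; _×_)

-- Distinctness of the witnesses (Unique) is what makes this a lower bound on
-- the number of naturals satisfying P.
AtLeast : ℕ → (ℕ → Set) → Set
AtLeast m P = ∃[ xs ] Unique xs × All P xs × m ≤ length xs

{-# OPTIONS --safe #-}

-- Put N = k n and m = ⌊N / 2⌋ ≥ n; it suffices to find k - 1 ≤ √N - 1 primes p with m < p < N.
-- As in Erdős's proof of Bertrand's postulate, every prime power dividing C(2m, m) is at most
-- M = 2m + 1, primes above √M divide it at most once, primes in (2m / 3, m] do not divide it, and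
-- the primes up to 2m / 3 have product at most 4^(2m / 3). With R primes in (m, 2m] this gives
-- 4^m ≤ 2m C(2m, m) ≤ M ^ (2 + √M + R) 4^(2m / 3), and R ≤ √M - 2 is impossible once M ≥ 2^13.
-- Smaller N are settled by evaluation.
module Submission where

open import Data.Bool.Base using (Bool; true; false) renaming (T to IsTrue)
open import Data.Empty using (⊥)
open import Data.List.Base using (List; []; _∷_; length; map; filter; applyDownFrom; downFrom)
open import Data.List.Membership.Propositional using (lose)
open import Data.List.Relation.Unary.All as All using (All; []; _∷_)
import Data.List.Relation.Unary.All.Properties as All
open import Data.List.Relation.Unary.Any using (Any; here; there)
import Data.List.Relation.Unary.Unique.Propositional.Properties as Unique
open import Data.Nat.Base
open import Data.Nat.Divisibility
open import Data.Nat.Induction using (<-rec)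
open import Data.Nat.ListAction using (product)
open import Data.Nat.Primality
open import Data.Nat.Primality.Factorisation using (factorise; module PrimeFactorisation)
open import Data.Nat.Properties
open import Data.List.Membership.DecPropositional _≟_ using (_∈?_)
open import Data.Nat.Tactic.RingSolver using (solve-∀)
open import Data.Product.Base using (∃-syntax; ∃₂; _×_; _,_; proj₁; proj₂)
open import Data.Sum.Base using (_⊎_; inj₁; inj₂; [_,_]′)
open import Data.Unit.Base using (⊤; tt)
open import Function.Base using (_∘_; id; const)
open import Relation.Binary.PropositionalEquality
open import Relation.Nullary using (¬_; Dec; yes; no; contradiction)
open import Relation.Nullary.Decidable using (_×-dec_; _→-dec_; toWitness; from-yes; T?)
open import Relation.Unary using (Decidable)
open import Defs

-- Binomial coefficients

-- binom a b is the binomial coefficient C(a + b, a).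
binom : ℕ → ℕ → ℕ
binom zero    _       = 1
binom (suc _) zero    = 1
binom (suc a) (suc b) = binom a (suc b) + binom (suc a) b

binom-zeroʳ : ∀ a → binom a 0 ≡ 1
binom-zeroʳ zero    = refl
binom-zeroʳ (suc _) = refl

binom-comm : ∀ a b → binom a b ≡ binom b a
binom-comm zero    b       = sym (binom-zeroʳ b)
binom-comm (suc a) zero    = refl
binom-comm (suc a) (suc b) =
  trans (cong₂ _+_ (binom-comm a (suc b)) (binom-comm (suc a) b))
        (+-comm (binom (suc b) a) _)

binom>0 : ∀ a b → binom a b > 0
binom>0 zero    b       = s≤s z≤n
binom>0 (suc a) zero    = s≤s z≤n
binom>0 (suc a) (suc b) = m≤n⇒m≤n+o _ (binom>0 a (suc b))

binom-nonZero : ∀ a b → NonZero (binom a b)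
binom-nonZero a b = >-nonZero (binom>0 a b)

mutual
  -- The two absorption identities are proved together: Pascal's rule leaves one foreign summand,
  -- and both identities, applied to it one step earlier, turn it into a multiple of the other
  -- summand.
  binom-sucˡ : ∀ a b → suc a * binom (suc a) b ≡ suc (a + b) * binom a b
  binom-sucˡ a zero rewrite binom-zeroʳ a | +-identityʳ a = refl
  binom-sucˡ zero (suc b) = begin
    1 * (1 + binom 1 b)  ≡⟨ cong (λ x → 1 * (1 + x)) (trans (sym (*-identityˡ _)) (binom-sucˡ 0 b)) ⟩
    1 * (1 + suc b * 1)  ≡⟨ *-identityˡ _ ⟩
    suc (suc b) * 1      ∎
    where open ≡-Reasoning
  binom-sucˡ (suc a) (suc b) = begin
    suc (suc a) * (x + binom (suc (suc a)) b)
      ≡⟨ *-distribˡ-+ (suc (suc a)) x _ ⟩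
    suc (suc a) * x + suc (suc a) * binom (suc (suc a)) b
      ≡⟨ cong (suc (suc a) * x +_) (trans (binom-sucˡ (suc a) b) (sym (binom-sucʳ (suc a) b))) ⟩
    suc (suc a) * x + suc b * x
      ≡⟨ *-distribʳ-+ x (suc (suc a)) (suc b) ⟨
    suc (suc a + suc b) * x ∎
    where open ≡-Reasoning
          x = binom (suc a) (suc b)

  binom-sucʳ : ∀ a b → suc b * binom a (suc b) ≡ suc (a + b) * binom a b
  binom-sucʳ zero    b    = refl
  binom-sucʳ (suc a) zero rewrite +-identityʳ a = begin
    1 * (binom a 1 + 1)  ≡⟨ cong (λ x → 1 * (x + 1)) (trans (sym (*-identityˡ _)) (binom-sucʳ a 0)) ⟩
    1 * (suc (a + 0) * binom a 0 + 1) ≡⟨ cong₂ (λ x y → 1 * (suc x * y + 1)) (+-identityʳ a) (binom-zeroʳ a) ⟩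
    1 * (suc a * 1 + 1)  ≡⟨ identity a ⟩
    suc (suc a) * 1 ∎
    where open ≡-Reasoning
          identity : ∀ a → 1 * (suc a * 1 + 1) ≡ suc (suc a) * 1
          identity = solve-∀
  binom-sucʳ (suc a) (suc b) = begin
    suc (suc b) * (binom a (suc (suc b)) + x)
      ≡⟨ *-distribˡ-+ (suc (suc b)) (binom a (suc (suc b))) x ⟩
    suc (suc b) * binom a (suc (suc b)) + suc (suc b) * x
      ≡⟨ cong (_+ suc (suc b) * x) (trans (binom-sucʳ a (suc b)) (sym (binom-sucˡ a (suc b)))) ⟩
    suc a * x + suc (suc b) * x
      ≡⟨ *-distribʳ-+ x (suc a) (suc (suc b)) ⟨
    (suc a + suc (suc b)) * x
      ≡⟨ cong (_* x) (+-suc (suc a) (suc b)) ⟩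
    suc (suc a + suc b) * x ∎
    where open ≡-Reasoning
          x = binom (suc a) (suc b)

-- Pascal's rule doubles the bound at each step. It beats the row sum 2^(a + b + 2) by a factor 2,
-- which is what halving C(2m + 2, m + 1) to C(2m + 1, m) needs in order to end at 4^m.
binom-suc-suc≤ : ∀ a b → binom (suc a) (suc b) ≤ 2 ^ suc (a + b)
binom-suc-suc≤ zero zero = ≤-refl
binom-suc-suc≤ zero (suc b) = begin
  1 + binom 1 (suc b)         ≤⟨ +-mono-≤ (m^n>0 2 (suc b)) (binom-suc-suc≤ 0 b) ⟩
  2 ^ suc b + 2 ^ suc b       ≡⟨ cong (2 ^ suc b +_) (+-identityʳ _) ⟨
  2 ^ suc (suc b)             ∎
  where open ≤-Reasoning
binom-suc-suc≤ (suc a) zero = begin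
  binom (suc a) 1 + 1             ≤⟨ +-mono-≤ (binom-suc-suc≤ a 0) (m^n>0 2 (suc (a + 0))) ⟩
  2 ^ suc (a + 0) + 2 ^ suc (a + 0)       ≡⟨ cong (2 ^ suc (a + 0) +_) (+-identityʳ _) ⟨
  2 ^ suc (suc (a + 0))             ∎
  where open ≤-Reasoning
binom-suc-suc≤ (suc a) (suc b) = begin
  binom (suc a) (suc (suc b)) + binom (suc (suc a)) (suc b)
    ≤⟨ +-mono-≤ (binom-suc-suc≤ a (suc b)) (binom-suc-suc≤ (suc a) b) ⟩
  2 ^ suc (a + suc b) + 2 ^ suc (suc (a + b))
    ≡⟨ cong (λ x → 2 ^ suc (a + suc b) + 2 ^ suc x) (+-suc a b) ⟨
  2 ^ suc (a + suc b) + 2 ^ suc (a + suc b)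
    ≡⟨ cong (2 ^ suc (a + suc b) +_) (+-identityʳ _) ⟨
  2 ^ suc (suc (a + suc b)) ∎
  where open ≤-Reasoning

central-suc : ∀ m → binom (suc m) (suc m) ≡ 2 * binom (suc m) m
central-suc m = trans (cong (_+ binom (suc m) m) (binom-comm m (suc m)))
                      (cong (binom (suc m) m +_) (sym (+-identityʳ _)))

binom[1+m,m]≤ : ∀ m → binom (suc m) m ≤ 2 ^ (m + m)
binom[1+m,m]≤ m = *-cancelˡ-≤ 2 (subst (_≤ 2 ^ suc (m + m)) (central-suc m) (binom-suc-suc≤ m m))

central≤ : ∀ m → binom m m ≤ 2 ^ (m + m)
central≤ zero    = ≤-refl
central≤ (suc m) = ≤-trans (binom-suc-suc≤ m m) (^-monoʳ-≤ 2 (s≤s (+-monoʳ-≤ m (n≤1+n m))))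

central-recurrence : ∀ m → suc m * binom (suc m) (suc m) ≡ 2 * (suc (m + m) * binom m m)
central-recurrence m = begin
  suc m * binom (suc m) (suc m)    ≡⟨ cong (suc m *_) (central-suc m) ⟩
  suc m * (2 * binom (suc m) m)    ≡⟨ rearrange (suc m) (binom (suc m) m) ⟩
  2 * (suc m * binom (suc m) m)    ≡⟨ cong (2 *_) (binom-sucˡ m m) ⟩
  2 * (suc (m + m) * binom m m)    ∎
  where
  open ≡-Reasoning
  rearrange : ∀ x y → x * (2 * y) ≡ 2 * (x * y)
  rearrange = solve-∀

-- By `central-recurrence`, passing from m to m + 1 multiplies 2m C(2m, m) by 4 (2m + 1) / (2m),
-- which exceeds 4; the two sides agree at m = 1.
central-lower : ∀ m .{{_ : NonZero m}} → 2 ^ (m + m) ≤ (m + m) * binom m m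
central-lower (suc zero)      = ≤-refl
central-lower (suc m@(suc _)) = begin
  2 ^ (suc m + suc m)             ≡⟨ cong (λ x → 2 * 2 ^ x) (+-suc m m) ⟩
  2 * (2 * 2 ^ (m + m))           ≤⟨ *-monoʳ-≤ 2 (*-monoʳ-≤ 2 (central-lower m)) ⟩
  2 * (2 * ((m + m) * binom m m)) ≤⟨ *-monoʳ-≤ 2 (*-monoʳ-≤ 2 (*-monoˡ-≤ (binom m m) (n≤1+n (m + m)))) ⟩
  2 * (2 * (suc (m + m) * binom m m)) ≡⟨ cong (2 *_) (central-recurrence m) ⟨
  2 * (suc m * binom (suc m) (suc m)) ≡⟨ rearrange (suc m) (binom (suc m) (suc m)) ⟩
  (suc m + suc m) * binom (suc m) (suc m) ∎
  where
  open ≤-Reasoning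
  rearrange : ∀ x y → 2 * (x * y) ≡ (x + x) * y
  rearrange = solve-∀

-- Leibniz's harmonic triangle: the reciprocals of the numbers
-- L a b = (a + b + 1) binom a b satisfy 1 / L a b = 1 / L (a + 1) b + 1 / L a (b + 1),
-- so every common multiple of 1, …, a + b + 1 is a multiple of L a b.
leibniz∣ : ∀ D a b → (∀ j .{{_ : NonZero j}} → j ≤ suc (a + b) → j ∣ D) →
           suc (a + b) * binom a b ∣ D
leibniz∣ D a zero mult rewrite binom-zeroʳ a | *-identityʳ (a + 0) = mult (suc (a + 0)) ≤-refl
leibniz∣ D a (suc b) mult = step (leibniz∣ D a b (λ j j≤ → mult j (≤-trans j≤ (s≤s (+-monoʳ-≤ a (n≤1+n b))))))
    (leibniz∣ D (suc a) b (λ j j≤ → mult j (≤-trans j≤ (≤-reflexive (cong suc (sym (+-suc a b)))))))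
  where
  s = suc (suc (a + b))
  T = suc (a + b) * binom a b
  U = suc (suc a + b) * binom (suc a) b
  V = suc (a + suc b) * binom a (suc b)
  instance
    T≢0 : NonZero T
    T≢0 = m*n≢0 (suc (a + b)) (binom a b) {{_}} {{binom-nonZero a b}}
  swap : ∀ x y z → x * (y * z) ≡ y * (x * z)
  swap = solve-∀
  V-eq : suc b * V ≡ s * T
  V-eq = begin
    suc b * (suc (a + suc b) * binom a (suc b)) ≡⟨ swap (suc b) (suc (a + suc b)) _ ⟩
    suc (a + suc b) * (suc b * binom a (suc b)) ≡⟨ cong₂ (λ x y → suc x * y) (+-suc a b) (binom-sucʳ a b) ⟩
    s * T ∎
    where open ≡-Reasoning
  U-eq : suc a * U ≡ s * T
  U-eq = trans (swap (suc a) s (binom (suc a) b)) (cong (s *_) (binom-sucˡ a b))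
  step : T ∣ D → U ∣ D → V ∣ D
  step (divides x D≡xT) (divides y D≡yU) = divides z (*-cancelˡ-≡ D (z * V) s (sym szV≡sD))
    where
    open ≡-Reasoning
    [1+a]x≡sy : suc a * x ≡ s * y
    [1+a]x≡sy = *-cancelʳ-≡ (suc a * x) (s * y) T (begin
      suc a * x * T     ≡⟨ *-assoc (suc a) x T ⟩
      suc a * (x * T)   ≡⟨ cong (suc a *_) (trans (sym D≡xT) D≡yU) ⟩
      suc a * (y * U)   ≡⟨ swap (suc a) y U ⟩
      y * (suc a * U)   ≡⟨ cong (y *_) U-eq ⟩
      y * (s * T)       ≡⟨ swap y s T ⟩
      s * (y * T)       ≡⟨ *-assoc s y T ⟨
      s * y * T         ∎)
    y≤x : y ≤ x
    y≤x = *-cancelˡ-≤ s (≤-trans (≤-reflexive (sym [1+a]x≡sy)) (*-monoˡ-≤ x (s≤s (m≤n⇒m≤1+n (m≤m+n a b)))))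
    -- `z` is the quotient D / V, since the relation between the reciprocals gives D / V = D / T - D
    -- / U.
    z = x ∸ y
    sz≡[1+b]x : s * z ≡ suc b * x
    sz≡[1+b]x = +-cancelˡ-≡ (s * y) _ _ (begin
      s * y + s * z         ≡⟨ *-distribˡ-+ s y z ⟨
      s * (y + z)           ≡⟨ cong (s *_) (m+[n∸m]≡n y≤x) ⟩
      s * x                 ≡⟨ split a b x ⟩
      suc a * x + suc b * x ≡⟨ cong (_+ suc b * x) [1+a]x≡sy ⟩
      s * y + suc b * x     ∎)
      where
      split : ∀ a b x → suc (suc (a + b)) * x ≡ suc a * x + suc b * x
      split = solve-∀
    szV≡sD : s * (z * V) ≡ s * D
    szV≡sD = begin
      s * (z * V)     ≡⟨ *-assoc s z V ⟨
      s * z * V       ≡⟨ cong (_* V) sz≡[1+b]x ⟩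
      suc b * x * V   ≡⟨ cong (_* V) (*-comm (suc b) x) ⟩
      x * suc b * V   ≡⟨ *-assoc x (suc b) V ⟩
      x * (suc b * V) ≡⟨ cong (x *_) V-eq ⟩
      x * (s * T)     ≡⟨ swap x s T ⟩
      s * (x * T)     ≡⟨ cong (s *_) D≡xT ⟨
      s * D           ∎

-- Primes and prime powers in binomial coefficients

prime⇒>1 : ∀ {p} → Prime p → 1 < p
prime⇒>1 (prime _) = nonTrivial⇒n>1 _

prime∤1 : ∀ {p} → Prime p → p ∤ 1
prime∤1 p-prime p∣1 = <⇒≢ (prime⇒>1 p-prime) (sym (∣1⇒≡1 p∣1))

∤-* : ∀ {p} → Prime p → ∀ m n → p ∤ m → p ∤ n → p ∤ m * n
∤-* p-prime m n p∤m p∤n p∣mn = [ p∤m , p∤n ]′ (euclidsLemma m n p-prime p∣mn)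

∣-cancel : ∀ {p} → Prime p → ∀ m n → p ∤ m → p ∣ m * n → p ∣ n
∣-cancel p-prime m n p∤m p∣mn = [ (λ p∣m → contradiction p∣m p∤m) , id ]′ (euclidsLemma m n p-prime p∣mn)

strictly-between-multiples : ∀ {p n} i → i * p < n → n < suc i * p → p ∤ n
strictly-between-multiples {p} i ip<n n<[1+i]p (divides q refl) =
  <⇒≱ (*-cancelʳ-< p q (suc i) n<[1+i]p) (*-cancelʳ-< p i q ip<n)

-- Takes integer parts of inverse functions: with powers, squares or multiples as `f` it yields
-- logarithms, square roots or quotients, rounded down.
bracket : ∀ (f : ℕ → ℕ) {x} b → f 0 ≤ x → x < f b → ∃[ s ] f s ≤ x × x < f (suc s)
bracket f zero    f0≤x x<f0 = contradiction f0≤x (<⇒≱ x<f0)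
bracket f {x} (suc b) f0≤x x<fb with f b ≤? x
... | yes fb≤x = b , fb≤x , x<fb
... | no  fb≰x = bracket f b f0≤x (≰⇒> fb≰x)

m<n^m : ∀ {n} → 1 < n → ∀ m → m < n ^ m
m<n^m 1<n zero    = ≤-refl
m<n^m {n} 1<n (suc m) = begin-strict
  suc m         ≤⟨ m<n^m 1<n m ⟩
  n ^ m         <⟨ m<n*m (n ^ m) {{>-nonZero (≤-<-trans z≤n (m<n^m 1<n m))}} n 1<n ⟩
  n * n ^ m     ∎
  where open ≤-Reasoning
        m<n*m : ∀ m .{{_ : NonZero m}} n → 1 < n → m < n * m
        m<n*m m n 1<n = subst (_< n * m) (*-identityˡ m) (*-monoˡ-< m 1<n)

Stripped : ℕ → ℕ → Set
Stripped p X = ∃[ e ] ∃[ Y ] X ≡ p ^ e * Y × p ∤ Y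

strip : ∀ {p} → 1 < p → ∀ X .{{_ : NonZero X}} → Stripped p X
strip {p} 1<p X = go X
  where
  go : ∀ X .{{_ : NonZero X}} → Stripped p X
  go = <-rec (λ X → .{{NonZero X}} → Stripped p X) step
    where
    step : ∀ X → (∀ {Y} → Y < X → .{{NonZero Y}} → Stripped p Y) → .{{NonZero X}} → Stripped p X
    step X rec with p ∣? X
    ... | no  p∤X = 0 , X , sym (*-identityˡ X) , p∤X
    ... | yes p∣X@(divides q X≡qp) with rec (quotient-< p∣X {{n>1⇒nonTrivial 1<p}}) {{quotient≢0 p∣X}}
    ... | e , Y , q≡ , p∤Y = suc e , Y , trans X≡qp (trans (*-comm q p) (trans (cong (p *_) q≡) (sym (*-assoc p (p ^ e) Y)))) , p∤Y

^-mono-∣ : ∀ p {d e} → d ≤ e → p ^ d ∣ p ^ e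
^-mono-∣ p {d} {e} d≤e = subst (λ x → p ^ d ∣ p ^ x) (m+[n∸m]≡n d≤e)
  (subst (p ^ d ∣_) (sym (^-distribˡ-+-* p d (e ∸ d))) (m∣m*n (p ^ (e ∸ d))))

∤-cofactor : ∀ {p} → Prime p → ∀ f {Q e} → p ∤ Q → p ^ e ∣ p ^ f * Q → e ≤ f
∤-cofactor {p} p-prime f {Q} {e} p∤Q p^e∣ with e ≤? f
... | yes e≤f = e≤f
... | no  e≰f = contradiction (*-cancelˡ-∣ (p ^ f) {{m^n≢0 p f {{prime⇒nonZero p-prime}}}}
        (∣-trans (∣-reflexive (*-comm (p ^ f) p)) (∣-trans (^-mono-∣ p (≰⇒> e≰f)) p^e∣))) p∤Q

-- Serves in place of the least common multiple of 1, ..., n: `Q` is the product of their parts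
-- prime to p, and `p ^ f` absorbs every power of p because none of these numbers reaches
-- `p ^ suc f`.
common-multiple : ∀ {p} → Prime p → ∀ f n → n < p ^ suc f →
  ∃[ Q ] p ∤ Q × (∀ j .{{_ : NonZero j}} → j ≤ n → j ∣ p ^ f * Q)
common-multiple p-prime f zero    _ = 1 , prime∤1 p-prime , λ j j≤0 → contradiction j≤0 (<⇒≱ (>-nonZero⁻¹ j))
common-multiple {p} p-prime f (suc n) n<p^1+f
  with common-multiple p-prime f n (<-trans (n<1+n n) n<p^1+f) | strip (prime⇒>1 p-prime) (suc n)
... | Q , p∤Q , mult | e , Y , 1+n≡ , p∤Y = Q * Y , ∤-* p-prime Q Y p∤Q p∤Y , mult′
  where
  instance
    p≢0 : NonZero p
    p≢0 = prime⇒nonZero p-prime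
    Y≢0 : NonZero Y
    Y≢0 = ≢-nonZero λ { refl → p∤Y (p ∣0) }
  e<1+f : e < suc f
  e<1+f = ≰⇒> λ 1+f≤e → <⇒≱ n<p^1+f (≤-trans (^-monoʳ-≤ p 1+f≤e)
            (≤-trans (m≤m*n (p ^ e) Y) (≤-reflexive (sym 1+n≡))))
  mult′ : ∀ j .{{_ : NonZero j}} → j ≤ suc n → j ∣ p ^ f * (Q * Y)
  mult′ j j≤1+n with m≤n⇒m<n∨m≡n j≤1+n
  ... | inj₁ j<1+n = ∣-trans (mult j (s≤s⁻¹ j<1+n)) (*-monoʳ-∣ (p ^ f) (m∣m*n Y))
  ... | inj₂ refl  = subst (_∣ p ^ f * (Q * Y)) (sym 1+n≡) (*-pres-∣ (^-mono-∣ p (s≤s⁻¹ e<1+f)) (n∣m*n Q))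

-- Let p^f be the largest power of p up to n = a + b + 1. The Leibniz number n C(a + b, a) divides a
-- common multiple p^f Q with p ∤ Q, so e ≤ f. This takes the place of Legendre's formula for
-- factorials.
prime-power∣binom⇒≤ : ∀ {p} → Prime p → ∀ a b e → p ^ e ∣ binom a b → p ^ e ≤ suc (a + b)
prime-power∣binom⇒≤ {p} p-prime a b e p^e∣ = bound (bracket (p ^_) n (s≤s z≤n) (m<n^m (prime⇒>1 p-prime) n))
  where
  n = suc (a + b)
  bound : ∃[ f ] p ^ f ≤ n × n < p ^ suc f → p ^ e ≤ n
  bound (f , p^f≤n , n<p^1+f) with common-multiple p-prime f n n<p^1+f
  ... | Q , p∤Q , mult = ≤-trans (^-monoʳ-≤ p {{prime⇒nonZero p-prime}} (∤-cofactor p-prime f {e = e} p∤Q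
          (∣-trans p^e∣ (∣-trans (n∣m*n n) (leibniz∣ (p ^ f * Q) a b mult))))) p^f≤n

prime∤binom-large : ∀ {p} → Prime p → ∀ a b → a + b < p → p ∤ binom a b
prime∤binom-large p-prime a zero    _ p∣ rewrite binom-zeroʳ a = prime∤1 p-prime p∣
prime∤binom-large {p} p-prime a (suc b) a+b<p p∣ =
  ∤-* p-prime (suc (a + b)) (binom a b) (>⇒∤ 1+a+b<p)
    (prime∤binom-large p-prime a b (<-trans (n<1+n (a + b)) 1+a+b<p))
    (subst (p ∣_) (binom-sucʳ a b) (∣n⇒∣m*n (suc b) p∣))
  where 1+a+b<p = subst (_< p) (+-suc a b) a+b<p

-- As b grows, the numerator a + b + 1 of the recurrence meets p once, and no denominator b + 1 < p
-- can cancel it.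
prime∣binom : ∀ {p} → Prime p → ∀ a b → a < p → b < p → p ≤ a + b → p ∣ binom a b
prime∣binom {p} p-prime a zero    a<p _ p≤a = contradiction (subst (p ≤_) (+-identityʳ a) p≤a) (<⇒≱ a<p)
prime∣binom {p} p-prime a (suc b) a<p b<p p≤ =
  ∣-cancel p-prime (suc b) _ (>⇒∤ b<p) (subst (p ∣_) (sym (binom-sucʳ a b)) p∣rhs)
  where
  p∣rhs : p ∣ suc (a + b) * binom a b
  p∣rhs with m≤n⇒m<n∨m≡n (subst (p ≤_) (+-suc a b) p≤)
  ... | inj₁ p<     = ∣n⇒∣m*n (suc (a + b)) (prime∣binom p-prime a b a<p (<-trans (n<1+n b) b<p) (s≤s⁻¹ p<))
  ... | inj₂ refl = m∣m*n (binom a b)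

-- Up to the denominator b!, the coefficient is (p + 1) ⋯ (p + b), whose factors lie strictly
-- between p and 2p.
prime∤binom-p : ∀ {p} → Prime p → ∀ b → b < p → p ∤ binom p b
prime∤binom-p {p} p-prime zero    _   p∣ rewrite binom-zeroʳ p = prime∤1 p-prime p∣
prime∤binom-p {p} p-prime (suc b) b<p p∣ =
  ∤-* p-prime (suc (p + b)) (binom p b)
    (λ p∣1+p+b → >⇒∤ b<p (∣m+n∣m⇒∣n (subst (p ∣_) (sym (+-suc p b)) p∣1+p+b) ∣-refl))
    (prime∤binom-p p-prime b (<-trans (n<1+n b) b<p))
    (subst (p ∣_) (binom-sucʳ p b) (∣n⇒∣m*n (suc b) p∣))

-- Start from C(2p, p) = 2 C(2p - 1, p) and follow `central-recurrence` up to p + r: the numerators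
-- contributed are 2 and odd numbers strictly between 2p and 3p, none of them divisible by p.
prime∤central : ∀ {p} → Prime p → 2 < p → ∀ r → 2 * (p + r) < 3 * p → p ∤ binom (p + r) (p + r)
prime∤central {p@(suc q)} p-prime 2<p zero 2m<3p p∣ rewrite +-identityʳ q =
  ∤-* p-prime 2 (binom p q) (>⇒∤ 2<p) (prime∤binom-p p-prime q ≤-refl) (subst (p ∣_) (central-suc q) p∣)
prime∤central {p} p-prime 2<p (suc r) 2m<3p p∣ rewrite +-suc p r =
  ∤-* p-prime 2 _ (>⇒∤ 2<p)
    (∤-* p-prime (suc (m + m)) (binom m m)
      (strictly-between-multiples 2 (s≤s 2p≤m+m) (<-trans 1+m+m<2[1+m] 2m<3p))
      (prime∤central p-prime 2<p r (≤-<-trans (*-monoʳ-≤ 2 (n≤1+n m)) 2m<3p)))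
    (subst (p ∣_) (central-recurrence m) (∣n⇒∣m*n (suc m) p∣))
  where
  m = p + r
  2p≤m+m : 2 * p ≤ m + m
  2p≤m+m = ≤-trans (*-monoʳ-≤ 2 (m≤m+n p r)) (≤-reflexive (cong (m +_) (+-identityʳ m)))
  1+m+m<2[1+m] : suc (m + m) < 2 * suc m
  1+m+m<2[1+m] = ≤-reflexive (identity m)
    where
    identity : ∀ m → suc (suc (m + m)) ≡ 2 * suc m
    identity = solve-∀

-- Products over initial segments, and the primorial

∏ : (ℕ → ℕ) → ℕ → ℕ
∏ f n = product (map f (downFrom n))

∏-mono : ∀ {f g} n → (∀ {i} → i < n → f i ≤ g i) → ∏ f n ≤ ∏ g n
∏-mono zero    f≤g = ≤-refl
∏-mono (suc n) f≤g = *-mono-≤ (f≤g ≤-refl) (∏-mono n (f≤g ∘ m<n⇒m<1+n))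

∏-* : ∀ f g n → ∏ (λ i → f i * g i) n ≡ ∏ f n * ∏ g n
∏-* f g zero    = refl
∏-* f g (suc n) = trans (cong (f n * g n *_) (∏-* f g n)) (rearrange (f n) (g n) (∏ f n) (∏ g n))
  where
  rearrange : ∀ a b c d → a * b * (c * d) ≡ a * c * (b * d)
  rearrange = solve-∀

∏-const : ∀ M n → ∏ (λ _ → M) n ≡ M ^ n
∏-const M zero    = refl
∏-const M (suc n) = cong (M *_) (∏-const M n)

∏-truncate : ∀ f {s} n → s ≤ n → (∀ {i} → s ≤ i → f i ≡ 1) → ∏ f n ≡ ∏ f s
∏-truncate f zero    z≤n     f≡1 = refl
∏-truncate f {s} (suc n) s≤1+n f≡1 with m≤n⇒m<n∨m≡n s≤1+n
... | inj₂ refl  = refl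
... | inj₁ s<1+n = trans (cong₂ _*_ (f≡1 (s≤s⁻¹ s<1+n)) (∏-truncate f n (s≤s⁻¹ s<1+n) f≡1)) (*-identityˡ _)

_when_ : ∀ {P : Set} → ℕ → Dec P → ℕ
x when yes _ = x
x when no  _ = 1

when-yes : ∀ {P : Set} {x} (P? : Dec P) → P → x when P? ≡ x
when-yes (yes _) _ = refl
when-yes (no ¬p) p = contradiction p ¬p

when-no : ∀ {P : Set} {x} (P? : Dec P) → ¬ P → x when P? ≡ 1
when-no (yes p) ¬p = contradiction p ¬p
when-no (no _)  _  = refl

when≥1 : ∀ {P : Set} {x} (P? : Dec P) → (P → 1 ≤ x) → 1 ≤ x when P?
when≥1 (yes p) 1≤x = 1≤x p
when≥1 (no _)  _   = ≤-refl

when≤ : ∀ {P : Set} {x} (P? : Dec P) → 1 ≤ x → x when P? ≤ x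
when≤ (yes _) _   = ≤-refl
when≤ (no _)  1≤x = 1≤x

∏-when : ∀ {P : ℕ → Set} (P? : Decidable P) M n → ∏ (λ i → M when P? i) n ≡ M ^ length (filter P? (downFrom n))
∏-when P? M zero = refl
∏-when P? M (suc n) with P? n
... | yes _ = cong (M *_) (∏-when P? M n)
... | no  _ = trans (*-identityˡ _) (∏-when P? M n)

-- If `n` is prime, its full power in X is split off and bounded by `b n`, and the cofactor has only
-- smaller primes. Otherwise the factor `b n` ≥ 1 merely weakens the bound.
prime-powers-bound : ∀ b → (∀ p → 1 ≤ b p) → ∀ n X .{{_ : NonZero X}} →
  (∀ {p} → Prime p → p ∣ X → p < n) →
  (∀ {p} → Prime p → ∀ e → p ^ e ∣ X → p ^ e ≤ b p) →
  X ≤ ∏ b n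
prime-powers-bound b 1≤b zero X small pow with factorise X
-- No prime is left to divide X, so its factorisation is empty and X = 1.
... | record { factors = [] ; isFactorisation = refl } = ≤-refl
... | record { factors = p ∷ ps ; isFactorisation = refl ; factorsPrime = p-prime ∷ _ } =
  contradiction (small p-prime (m∣m*n (product ps))) λ ()
prime-powers-bound b 1≤b (suc n) X small pow with prime? n
... | no ¬n-prime = begin
  X             ≤⟨ prime-powers-bound b 1≤b n X small′ pow ⟩
  ∏ b n         ≤⟨ m≤n*m (∏ b n) (b n) {{>-nonZero (1≤b n)}} ⟩
  b n * ∏ b n   ∎
  where
  open ≤-Reasoning
  small′ : ∀ {p} → Prime p → p ∣ X → p < n
  small′ p-prime p∣X = ≤∧≢⇒< (s≤s⁻¹ (small p-prime p∣X)) λ { refl → ¬n-prime p-prime }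
... | yes n-prime with strip (prime⇒>1 n-prime) X
... | e , Y , X≡ , n∤Y = begin
  X             ≡⟨ X≡ ⟩
  n ^ e * Y     ≤⟨ *-mono-≤ (pow n-prime e (subst (n ^ e ∣_) (sym X≡) (m∣m*n Y)))
                            (prime-powers-bound b 1≤b n Y small′ (λ p-prime e p^e∣Y → pow p-prime e (∣-trans p^e∣Y Y∣X))) ⟩
  b n * ∏ b n   ∎
  where
  open ≤-Reasoning
  instance
    Y≢0 : NonZero Y
    Y≢0 = ≢-nonZero λ { refl → n∤Y (n ∣0) }
  Y∣X : Y ∣ X
  Y∣X = subst (Y ∣_) (sym X≡) (n∣m*n (n ^ e))
  small′ : ∀ {p} → Prime p → p ∣ Y → p < n
  small′ p-prime p∣Y = ≤∧≢⇒< (s≤s⁻¹ (small p-prime (∣-trans p∣Y Y∣X))) λ { refl → n∤Y p∣Y }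

primeFactor : ℕ → ℕ
primeFactor p = p when prime? p

-- Only primes strictly below n enter, so the usual n# is `primorial (suc n)`.
primorial : ℕ → ℕ
primorial n = ∏ primeFactor n

primeFactor≥1 : ∀ p → 1 ≤ primeFactor p
primeFactor≥1 p = when≥1 (prime? p) (<⇒≤ ∘ prime⇒>1)

prime∤primorial : ∀ {p} → Prime p → ∀ n → n ≤ p → p ∤ primorial n
prime∤primorial p-prime zero    _   = prime∤1 p-prime
prime∤primorial {p} p-prime (suc n) n<p = ∤-* p-prime (primeFactor n) (primorial n) p∤n (prime∤primorial p-prime n (<⇒≤ n<p))
  where
  p∤n : p ∤ primeFactor n
  p∤n with prime? n
  ... | yes n-prime = >⇒∤ {{prime⇒nonZero n-prime}} n<p
  ... | no  _       = prime∤1 p-prime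

-- A new prime `n` divides primorial a * X = q * primorial n but not the product of the smaller
-- primes, hence it divides the cofactor q.
primorial∣ : ∀ X {a} n → a ≤ n → (∀ {p} → Prime p → a ≤ p → p < n → p ∣ X) → primorial n ∣ primorial a * X
primorial∣ X zero z≤n div = 1∣ _
primorial∣ X {a} (suc n) a≤1+n div with m≤n⇒m<n∨m≡n a≤1+n
... | inj₂ refl  = m∣m*n X
... | inj₁ a<1+n with primorial∣ X n (s≤s⁻¹ a<1+n) (λ p-prime a≤p p<n → div p-prime a≤p (m<n⇒m<1+n p<n)) | prime? n
... | rec | no _ = subst (_∣ primorial a * X) (sym (*-identityˡ (primorial n))) rec
... | divides q eq | yes n-prime = subst (n * primorial n ∣_) (sym eq) (*-monoˡ-∣ (primorial n)
        (∣-cancel n-prime (primorial n) q (prime∤primorial n-prime n ≤-refl)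
          (subst (n ∣_) (trans eq (*-comm q (primorial n))) (∣n⇒∣m*n (primorial a) (div n-prime (s≤s⁻¹ a<1+n) ≤-refl)))))

primorial-mono : ∀ X .{{_ : NonZero X}} {a} n → a ≤ n →
  (∀ {p} → Prime p → a ≤ p → p < n → p ∣ X) → primorial n ≤ primorial a * X
primorial-mono X {a} n a≤n div = ∣⇒≤ {{m*n≢0 _ X {{primorial≢0 a}}}} (primorial∣ X n a≤n div)
  where
  primorial≢0 : ∀ n → NonZero (primorial n)
  primorial≢0 zero    = _
  primorial≢0 (suc n) = m*n≢0 (primeFactor n) _ {{>-nonZero (primeFactor≥1 n)}} {{primorial≢0 n}}

halve : ∀ n → ∃[ m ] (n ≡ m + m ⊎ n ≡ suc (m + m))
halve zero = 0 , inj₁ refl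
halve (suc n) with halve n
... | m , inj₁ refl = m , inj₂ refl
... | m , inj₂ refl = suc m , inj₁ (cong suc (sym (+-suc m m)))

-- Erdős's halving argument: the primes in (m, 2m] divide C(2m, m), those in (m + 1, 2m + 1] divide
-- C(2m + 1, m), and both coefficients are at most 4^m.
primorial≤4^n : ∀ n → primorial (suc n) ≤ 2 ^ (n + n)
primorial≤4^n = <-rec _ step
  where
  open ≤-Reasoning
  step : ∀ n → (∀ {m} → m < n → primorial (suc m) ≤ 2 ^ (m + m)) → primorial (suc n) ≤ 2 ^ (n + n)
  step n rec with halve n
  ... | zero  , inj₁ refl = ≤-refl
  ... | zero  , inj₂ refl = s≤s z≤n
  ... | m@(suc l) , inj₁ refl = begin
    primorial (suc (m + m))          ≤⟨ primorial-mono (binom m m) {{binom-nonZero m m}} (suc (m + m)) (s≤s (m≤m+n m m))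
                                        (λ p-prime m<p p≤m+m → prime∣binom p-prime m m m<p m<p (s≤s⁻¹ p≤m+m)) ⟩
    primorial (suc m) * binom m m    ≤⟨ *-mono-≤ (rec (m<m+n m z<s)) (central≤ m) ⟩
    2 ^ (m + m) * 2 ^ (m + m)        ≡⟨ ^-distribˡ-+-* 2 (m + m) (m + m) ⟨
    2 ^ (m + m + (m + m))            ∎
  ... | m@(suc l) , inj₂ refl = begin
    primorial (suc n)
      ≤⟨ primorial-mono (binom (suc m) m) {{binom-nonZero (suc m) m}} (suc n) (s≤s (s≤s (m≤m+n m m)))
           (λ p-prime 1+m<p p≤n → prime∣binom p-prime (suc m) m 1+m<p (<-trans (n<1+n m) 1+m<p) (s≤s⁻¹ p≤n)) ⟩
    primorial (suc (suc m)) * binom (suc m) m   ≤⟨ *-mono-≤ (rec (s≤s (m<m+n m z<s))) (binom[1+m,m]≤ m) ⟩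
    2 ^ (suc m + suc m) * 2 ^ (m + m)           ≡⟨ ^-distribˡ-+-* 2 (suc m + suc m) (m + m) ⟨
    2 ^ (suc m + suc m + (m + m))               ≡⟨ cong (2 ^_) (rearrange m) ⟩
    2 ^ (n + n)                                 ∎
    where
    rearrange : ∀ m → suc m + suc m + (m + m) ≡ suc (m + m) + suc (m + m)
    rearrange = solve-∀

-- The upper bound for the central binomial coefficient

when-mono : ∀ {P Q : Set} {x} (P? : Dec P) (Q? : Dec Q) → (P → Q) → (Q → 1 ≤ x) → x when P? ≤ x when Q?
when-mono (yes p) Q?      P⇒Q 1≤x = ≤-reflexive (sym (when-yes Q? (P⇒Q p)))
when-mono (no _)  Q?      P⇒Q 1≤x = when≥1 Q? 1≤x

primeAbove? : ∀ m → Decidable (λ p → Prime p × m < p)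
primeAbove? m p = prime? p ×-dec m <? p

primesAbove : ℕ → ℕ → List ℕ
primesAbove m n = filter (primeAbove? m) (downFrom n)

-- `S` is meant to be the integer square root of 2m + 1, plus one, and `c` to be 2m / 3 rounded
-- down.
module _ (m S c : ℕ) (2<S : 2 < S) (S≤M : S ≤ suc (m + m)) (M<S² : suc (m + m) < S * S)
         (c≤2m : c ≤ m + m) (2m<3[1+c] : 2 * m < 3 * suc c) where

  private
    M : ℕ
    M = suc (m + m)

    -- The shares of numbers below `S`, of primes up to `c` and of primes above `m`. The ranges may
    -- overlap: every factor is at least 1, so `b` remains an upper bound, and the three products
    -- can be estimated separately.
    u v w b : ℕ → ℕ
    u p = M when (p <? S)
    v p = p when (prime? p ×-dec p <? suc c)
    w p = M when primeAbove? m p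
    b p = u p * (v p * w p)

    u≥1 : ∀ p → 1 ≤ u p
    u≥1 p = when≥1 (p <? S) (λ _ → z<s)

    v≥1 : ∀ p → 1 ≤ v p
    v≥1 p = when≥1 (prime? p ×-dec p <? suc c) (<⇒≤ ∘ prime⇒>1 ∘ proj₁)

    w≥1 : ∀ p → 1 ≤ w p
    w≥1 p = when≥1 (primeAbove? m p) (λ _ → z<s)

    p≤vw : ∀ {p} → Prime p → S ≤ p → p ∣ binom m m → Dec (p < suc c) → Dec (m < p) → p ≤ v p * w p
    p≤vw {p} p-prime S≤p p∣ (yes p≤c) _ = begin
      p           ≡⟨ when-yes (prime? p ×-dec p <? suc c) (p-prime , p≤c) ⟨
      v p         ≤⟨ m≤m*n (v p) (w p) {{>-nonZero (w≥1 p)}} ⟩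
      v p * w p   ∎
      where open ≤-Reasoning
    p≤vw {p} p-prime S≤p p∣ (no _) (yes m<p) = begin
      p           ≤⟨ ≮⇒≥ (λ M<p → prime∤binom-large p-prime m m (<-trans (n<1+n (m + m)) M<p) p∣) ⟩
      M           ≡⟨ when-yes (primeAbove? m p) (p-prime , m<p) ⟨
      w p         ≤⟨ m≤n*m (w p) (v p) {{>-nonZero (v≥1 p)}} ⟩
      v p * w p   ∎
      where open ≤-Reasoning
    -- The remaining range c < p ≤ m contains no prime divisor: here 2m < 3p, and m is p + r with r
    -- = m ∸ p.
    p≤vw {p} p-prime S≤p p∣ (no p≰c) (no m≮p) = contradiction p∣
      (subst (λ x → p ∤ binom x x) p+r≡m
        (prime∤central p-prime (<-≤-trans 2<S S≤p) (m ∸ p)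
          (subst (λ x → 2 * x < 3 * p) (sym p+r≡m) (<-≤-trans 2m<3[1+c] (*-monoʳ-≤ 3 (≮⇒≥ p≰c))))))
      where
      p+r≡m : p + (m ∸ p) ≡ m
      p+r≡m = m+[n∸m]≡n (≮⇒≥ m≮p)

    p^e≤vw : ∀ {p} → Prime p → S ≤ p → ∀ e → p ^ e ∣ binom m m → p ^ e ≤ v p * w p
    p^e≤vw {p} p-prime S≤p zero p^e∣ = *-mono-≤ (v≥1 p) (w≥1 p)
    p^e≤vw {p} p-prime S≤p 1    p^e∣ = subst (_≤ v p * w p) (sym (*-identityʳ p))
      (p≤vw p-prime S≤p (subst (_∣ binom m m) (*-identityʳ p) p^e∣) (p <? suc c) (m <? p))
    -- A square of a prime from `S` on already exceeds M, the bound for every prime power in the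
    -- coefficient.
    p^e≤vw {p} p-prime S≤p (2+ e) p^e∣ = contradiction (begin
      S * S       ≤⟨ *-mono-≤ S≤p S≤p ⟩
      p * p       ≡⟨ cong (p *_) (*-identityʳ p) ⟨
      p ^ 2       ≤⟨ ^-monoʳ-≤ p {{prime⇒nonZero p-prime}} {2} {2+ e} (s≤s (s≤s z≤n)) ⟩
      p ^ 2+ e    ≤⟨ prime-power∣binom⇒≤ p-prime m m (2+ e) p^e∣ ⟩
      M           ∎) (<⇒≱ M<S²)
      where open ≤-Reasoning

    p^e≤b : ∀ {p} → Prime p → ∀ e → p ^ e ∣ binom m m → p ^ e ≤ b p
    p^e≤b {p} p-prime e p^e∣ = [ p-small , p-large ]′ (<-≤-connex p S)
      where
      open ≤-Reasoning
      p-small : p < S → p ^ e ≤ b p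
      p-small p<S = begin
        p ^ e               ≤⟨ prime-power∣binom⇒≤ p-prime m m e p^e∣ ⟩
        M                   ≡⟨ when-yes (p <? S) p<S ⟨
        u p                 ≤⟨ m≤m*n (u p) (v p * w p) {{>-nonZero (*-mono-≤ (v≥1 p) (w≥1 p))}} ⟩
        b p                 ∎
      p-large : S ≤ p → p ^ e ≤ b p
      p-large S≤p = ≤-trans (p^e≤vw p-prime S≤p e p^e∣) (m≤n*m (v p * w p) (u p) {{>-nonZero (u≥1 p)}})

    ∏u≤ : ∏ u M ≤ M ^ S
    ∏u≤ = begin
      ∏ u M          ≡⟨ ∏-truncate u M S≤M (λ {p} S≤p → when-no (p <? S) (≤⇒≯ S≤p)) ⟩
      ∏ u S          ≤⟨ ∏-mono S (λ {p} _ → when≤ (p <? S) z<s) ⟩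
      ∏ (const M) S  ≡⟨ ∏-const M S ⟩
      M ^ S          ∎
      where open ≤-Reasoning

    ∏v≤ : ∏ v M ≤ 2 ^ (c + c)
    ∏v≤ = begin
      ∏ v M              ≡⟨ ∏-truncate v M (s≤s c≤2m) (λ {p} c<p → when-no (prime? p ×-dec p <? suc c) (≤⇒≯ c<p ∘ proj₂)) ⟩
      ∏ v (suc c)        ≤⟨ ∏-mono (suc c) (λ {p} _ → when-mono (prime? p ×-dec p <? suc c) (prime? p) proj₁ (<⇒≤ ∘ prime⇒>1)) ⟩
      primorial (suc c)  ≤⟨ primorial≤4^n c ⟩
      2 ^ (c + c)        ∎
      where open ≤-Reasoning

  central-upper : binom m m ≤ M ^ S * (2 ^ (c + c) * M ^ length (primesAbove m M))
  central-upper = begin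
    binom m m                    ≤⟨ prime-powers-bound b (λ p → *-mono-≤ (u≥1 p) (*-mono-≤ (v≥1 p) (w≥1 p))) M (binom m m) {{binom-nonZero m m}}
                                     (λ p-prime p∣ → ≰⇒> λ M≤p → prime∤binom-large p-prime m m M≤p p∣) p^e≤b ⟩
    ∏ b M                        ≡⟨ ∏-* u (λ p → v p * w p) M ⟩
    ∏ u M * ∏ (λ p → v p * w p) M ≡⟨ cong (∏ u M *_) (∏-* v w M) ⟩
    ∏ u M * (∏ v M * ∏ w M)      ≤⟨ *-mono-≤ ∏u≤ (*-mono-≤ ∏v≤ (≤-reflexive (∏-when (primeAbove? m) M M))) ⟩
    M ^ S * (2 ^ (c + c) * M ^ length (primesAbove m M)) ∎
    where open ≤-Reasoning

-- Too few primes contradict the growth of the central binomial coefficient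

-- With t = 13 + j and T = t + 1 this is (6T + 1)² ≤ 2^t, where 85 = 6 * 14 + 1. The least t for
-- which it holds is 13 (7225 ≤ 8192), whence the threshold 2^13.
square≤2^ : ∀ j → (85 + 6 * j) * (85 + 6 * j) ≤ 2 ^ (13 + j)
square≤2^ zero    = m≤m+n 7225 967
square≤2^ (suc j) = begin
  (85 + 6 * suc j) * (85 + 6 * suc j)  ≡⟨ cong (λ x → (85 + x) * (85 + x)) {6 * suc j} {6 + 6 * j} (*-suc 6 j) ⟩
  (85 + (6 + 6 * j)) * (85 + (6 + 6 * j)) ≡⟨ expand (6 * j) ⟩
  y * y + (12 * y + 36)                ≤⟨ +-monoʳ-≤ (y * y) (+-monoʳ-≤ (12 * y) (m≤n⇒m≤n+o (6 * j) (m≤m+n 36 49))) ⟩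
  y * y + (12 * y + y)                 ≡⟨ cong (y * y +_) (+-comm (12 * y) y) ⟩
  y * y + 13 * y                       ≤⟨ +-monoʳ-≤ (y * y) (*-monoˡ-≤ y (m≤n⇒m≤n+o (6 * j) (m≤m+n 13 72))) ⟩
  y * y + y * y                        ≡⟨ cong (y * y +_) (+-identityʳ (y * y)) ⟨
  2 * (y * y)                          ≤⟨ *-monoʳ-≤ 2 (square≤2^ j) ⟩
  2 ^ (13 + suc j)                     ∎
  where
  open ≤-Reasoning
  y = 85 + 6 * j
  expand : ∀ x → (85 + (6 + x)) * (85 + (6 + x)) ≡ (85 + x) * (85 + x) + (12 * (85 + x) + 36)
  expand = solve-∀


square-cancel-< : ∀ {m n} → m * m < n * n → m < n
square-cancel-< m²<n² = ≰⇒> λ n≤m → <⇒≱ m²<n² (*-mono-≤ n≤m n≤m)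

-- Let s, t and c be √M, log₂ M and 2m / 3 rounded down, and T = t + 1. Fewer than k - 1 primes
-- means R + 2 ≤ s. Since M < 2^T, comparing exponents of 2 gives 2m ≤ 2Ts + 2c, hence 2m ≤ 6Ts and
-- s ≤ 6T; then M < (6T + 1)² ≤ 2^t ≤ M.
many-primes-above : ∀ m k → 2 ^ 13 ≤ suc (m + m) → k * k ≤ suc (m + m) → 2 ≤ k →
  k ∸ 1 ≤ length (primesAbove m (suc (m + m)))
many-primes-above m k 2^13≤M k²≤M 2≤k = ≮⇒≥ λ R<k∸1 → few-primes-absurd R<k∸1
    (bracket (λ s → s * s) (suc M) z≤n (≤-<-trans (m≤m*n M (suc M)) (*-monoˡ-< (suc M) (n<1+n M))))
    (bracket (2 ^_) M (s≤s z≤n) (m<n^m ≤-refl M))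
    (bracket (3 *_) (suc (m + m)) z≤n (m≤n*m (suc (m + m)) 3))
  where
  M = suc (m + m)
  R = length (primesAbove m M)
  m≢0 : ∀ m → 2 ^ 13 ≤ suc (m + m) → NonZero m
  m≢0 zero    (s≤s ())
  m≢0 (suc _) _ = _
  few-primes-absurd : R < k ∸ 1 → ∃[ s ] s * s ≤ M × M < suc s * suc s →
    ∃[ t ] 2 ^ t ≤ M × M < 2 ^ suc t → ∃[ c ] 3 * c ≤ m + m × m + m < 3 * suc c → ⊥
  few-primes-absurd R<k∸1 (s , s²≤M , M<[1+s]²) (t , 2^t≤M , M<2^T) (c , 3c≤2m , 2m<3[1+c]) =
    <⇒≱ M<[1+s]² (begin
      suc s * suc s                 ≤⟨ *-mono-≤ (s≤s s≤6T) (s≤s s≤6T) ⟩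
      suc (6 * T) * suc (6 * T)     ≡⟨ cong (λ x → x * x) 1+6T≡ ⟩
      (85 + 6 * (t ∸ 13)) * (85 + 6 * (t ∸ 13)) ≤⟨ square≤2^ (t ∸ 13) ⟩
      2 ^ (13 + (t ∸ 13))           ≡⟨ cong (2 ^_) 13+[t∸13]≡t ⟩
      2 ^ t                         ≤⟨ 2^t≤M ⟩
      M                             ∎)
    where
    open ≤-Reasoning
    T = suc t
    13+[t∸13]≡t : 13 + (t ∸ 13) ≡ t
    13+[t∸13]≡t = m+[n∸m]≡n {13} (≮⇒≥ λ t<13 → <⇒≱ M<2^T (≤-trans (^-monoʳ-≤ 2 {suc t} {13} t<13) 2^13≤M))
    1+6T≡ : suc (6 * T) ≡ 85 + 6 * (t ∸ 13)
    1+6T≡ = trans (cong (λ x → suc (6 * suc x)) (sym 13+[t∸13]≡t)) (cong suc (*-distribˡ-+ 6 14 (t ∸ 13)))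
    k≤s : k ≤ s
    k≤s = s≤s⁻¹ (square-cancel-< (≤-<-trans k²≤M M<[1+s]²))
    2≤s : 2 ≤ s
    2≤s = ≤-trans 2≤k k≤s
    1+s≤M : suc s ≤ M
    1+s≤M = ≤-trans (≤-trans (+-monoˡ-≤ s (<⇒≤ 2≤s)) (≤-reflexive (cong (s +_) (sym (+-identityʳ s)))))
                    (≤-trans (*-monoˡ-≤ s 2≤s) s²≤M)
    2+R≤s : 2 + R ≤ s
    2+R≤s = ≤-trans (s≤s R<k∸1) (≤-trans (≤-reflexive (m+[n∸m]≡n (<⇒≤ 2≤k))) k≤s)
    -- The exponent of M: one from the factor 2m ≤ M, s + 1 from the numbers below `suc s`, and R
    -- from the primes above m.
    2+s+R≤s+s : suc (suc s) + R ≤ s + s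
    2+s+R≤s+s = ≤-trans (≤-reflexive (rearrange s R)) (+-monoʳ-≤ s 2+R≤s)
      where
      rearrange : ∀ s R → suc (suc s) + R ≡ s + (2 + R)
      rearrange = solve-∀
    power-bound : 2 ^ (m + m) ≤ 2 ^ (T * (s + s) + (c + c))
    power-bound = begin
      2 ^ (m + m)
        ≤⟨ central-lower m {{m≢0 m 2^13≤M}} ⟩
      (m + m) * binom m m
        ≤⟨ *-mono-≤ (n≤1+n (m + m)) (central-upper m (suc s) c (s≤s 2≤s) 1+s≤M M<[1+s]²
             (≤-trans (m≤n*m c 3) 3c≤2m) (subst (_< 3 * suc c) (cong (m +_) (sym (+-identityʳ m))) 2m<3[1+c])) ⟩
      M * (M ^ suc s * (2 ^ (c + c) * M ^ R))
        ≡⟨ rearrange M (M ^ suc s) (2 ^ (c + c)) (M ^ R) ⟩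
      M ^ suc (suc s) * M ^ R * 2 ^ (c + c)
        ≡⟨ cong (_* 2 ^ (c + c)) (^-distribˡ-+-* M (suc (suc s)) R) ⟨
      M ^ (suc (suc s) + R) * 2 ^ (c + c)
        ≤⟨ *-monoˡ-≤ (2 ^ (c + c)) (≤-trans (^-monoʳ-≤ M 2+s+R≤s+s) (^-monoˡ-≤ (s + s) (<⇒≤ M<2^T))) ⟩
      (2 ^ T) ^ (s + s) * 2 ^ (c + c)
        ≡⟨ cong (_* 2 ^ (c + c)) (^-*-assoc 2 T (s + s)) ⟩
      2 ^ (T * (s + s)) * 2 ^ (c + c)
        ≡⟨ ^-distribˡ-+-* 2 (T * (s + s)) (c + c) ⟨
      2 ^ (T * (s + s) + (c + c)) ∎
      where
      rearrange : ∀ x y z w → x * (y * (z * w)) ≡ x * y * w * z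
      rearrange = solve-∀
    2m≤ : m + m ≤ T * (s + s) + (c + c)
    2m≤ = ≮⇒≥ λ lt → <⇒≱ (^-monoʳ-< 2 ≤-refl lt) power-bound
    -- Tripling allows 3c ≤ 2m to be used; 4m then cancels from both sides.
    2m≤6Ts : m + m ≤ 6 * T * s
    2m≤6Ts = +-cancelʳ-≤ (2 * (m + m)) (m + m) (6 * T * s) (begin
      (m + m) + 2 * (m + m)            ≡⟨⟩
      3 * (m + m)                      ≤⟨ *-monoʳ-≤ 3 2m≤ ⟩
      3 * (T * (s + s) + (c + c))      ≡⟨ rearrange T s c ⟩
      6 * T * s + 2 * (3 * c)          ≤⟨ +-monoʳ-≤ (6 * T * s) (*-monoʳ-≤ 2 3c≤2m) ⟩
      6 * T * s + 2 * (m + m)          ∎)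
      where
      rearrange : ∀ T s c → 3 * (T * (s + s) + (c + c)) ≡ 6 * T * s + 2 * (3 * c)
      rearrange = solve-∀
    s≤6T : s ≤ 6 * T
    s≤6T = ≮⇒≥ λ 6T<s → <⇒≱ (begin-strict
      M                      ≤⟨ s≤s 2m≤6Ts ⟩
      1 + 6 * T * s          <⟨ +-monoˡ-< (6 * T * s) 2≤s ⟩
      suc (6 * T) * s        ≤⟨ *-monoˡ-≤ s 6T<s ⟩
      s * s                  ∎) s²≤M

-- Small cases by evaluation

-- Exhausted fuel answers `false`, so only `true` carries information; a missed prime could only
-- lower the counts, never falsify them as lower bounds.
noDivisorFrom : (fuel d n : ℕ) → Bool
noDivisorFrom zero       d n = false
noDivisorFrom (suc fuel) d n with n <? d * d | d ∣? n
... | yes _ | _     = true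
... | no _  | yes _ = false
... | no _  | no _  = noDivisorFrom fuel (suc d) n

noDivisorFrom⇒prime : ∀ fuel d n .{{_ : NonTrivial n}} → d Rough n → IsTrue (noDivisorFrom fuel d n) → Prime n
noDivisorFrom⇒prime (suc fuel) d n rough t with n <? d * d | d ∣? n
... | yes n<d² | _      = rough∧square>⇒prime rough n<d²
... | no _     | no d∤n = noDivisorFrom⇒prime fuel (suc d) n (∤⇒rough-suc d∤n rough) t

-- The fuel bounds the divisors tried by 101, which decides primality below 10^4.
isPrime : ℕ → Bool
isPrime n@(2+ _) = noDivisorFrom 100 2 n
isPrime _        = false

isPrime⇒prime : ∀ n → IsTrue (isPrime n) → Prime n
isPrime⇒prime n@(2+ _) = noDivisorFrom⇒prime 100 2 n 2-rough

primesIn : ℕ → ℕ → List ℕ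
primesIn a b = filter (λ p → T? (isPrime p)) (applyDownFrom (a +_) (b ∸ a))

primesIn-atLeast : ∀ {a b n N} m → n < a → b ≤ N → m ≤ length (primesIn a b) →
  AtLeast m (λ p → Prime p × n < p × p < N)
primesIn-atLeast {a} {b} {n} {N} m n<a b≤N m≤ =
  primesIn a b ,
  Unique.filter⁺ P? (Unique.applyDownFrom⁺₁ (a +_) (b ∸ a) (λ j<i _ → <⇒≢ j<i ∘ sym ∘ +-cancelˡ-≡ a _ _)) ,
  All.zipWith (λ {p} (t , n<p<N) → isPrime⇒prime p t , n<p<N)
    (All.all-filter P? (applyDownFrom (a +_) (b ∸ a)) , All.filter⁺ P? (All.applyDownFrom⁺₁ (a +_) (b ∸ a) in-range)) ,
  m≤
  where
  P? = λ p → T? (isPrime p)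
  in-range : ∀ {i} → i < b ∸ a → n < a + i × a + i < N
  in-range {i} i<b∸a = <-≤-trans n<a (m≤m+n a i) ,
    <-≤-trans (subst (_≤ b) (+-suc a i) (a+j≤b i<b∸a)) b≤N
    where
    a≤b : a ≤ b
    a≤b = <⇒≤ (m∸n≢0⇒n<m λ b∸a≡0 → contradiction (subst (i <_) b∸a≡0 i<b∸a) λ ())
    a+j≤b : ∀ {j} → j ≤ b ∸ a → a + j ≤ b
    a+j≤b j≤ = ≤-trans (+-monoʳ-≤ a j≤) (≤-reflexive (m+[n∸m]≡n a≤b))

-- If a ≤ k * n < b then n < ⌈ b / 2 ⌉ because k ≥ 2, so the primes in [⌈ b / 2 ⌉ , a) lie
-- between n and k * n, and k ∸ 1 of them are enough because k * k ≤ k * n < b.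
Band : ℕ → ℕ → Set
Band a b = b ≤ h + h × b ≤ r * r
  where h = suc b / 2
        r = 2 + length (primesIn h a)

Bands : List ℕ → Set
Bands (a ∷ as@(b ∷ _)) = Band a b × Bands as
Bands _                = ⊤

bands? : ∀ as → Dec (Bands as)
bands? (a ∷ as@(b ∷ _)) = (_ ≤? _ ×-dec _ ≤? _) ×-dec bands? as
bands? []               = yes tt
bands? (_ ∷ [])         = yes tt

find-band : ∀ {N} a as → Bands (a ∷ as) → a ≤ N → Any (N <_) as → ∃₂ λ b c → Band b c × b ≤ N × N < c
find-band {N} a (b ∷ as) (band , bands) a≤N N<as with N <? b
... | yes N<b = a , b , band , a≤N , N<b
find-band a (b ∷ as) (band , bands) a≤N (here N<b)   | no N≮b = contradiction N<b N≮b
find-band a (b ∷ as) (band , bands) a≤N (there N<as) | no N≮b = find-band b as bands (≮⇒≥ N≮b) N<as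

-- Chosen greedily, starting from 42.
cuts : List ℕ
cuts = 46 ∷ 49 ∷ 58 ∷ 62 ∷ 74 ∷ 86 ∷ 100 ∷ 118 ∷ 144 ∷ 169 ∷ 206 ∷ 262 ∷ 334 ∷ 446 ∷ 622 ∷
       898 ∷ 1318 ∷ 2038 ∷ 3218 ∷ 5318 ∷ 8192 ∷ []

cuts-bands : Bands (42 ∷ cuts)
cuts-bands = toWitness {a? = bands? (42 ∷ cuts)} tt

AtLeastPrimes : ℕ → ℕ → Set
AtLeastPrimes n k = AtLeast (k ∸ 1) (λ p → Prime p × n < p × p < k * n)

-- These ranges exhaust k * n < 42: 2n ≤ k * n gives n < 21, and k² ≤ k * n < 49 gives k < 7.
tiny : ∀ {n} → n < 21 → ∀ {k} → k < 7 → k ≤ n → 2 ≤ k → k ∸ 1 ≤ length (primesIn (suc n) (k * n))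
tiny = toWitness {a? = allUpTo? (λ n → allUpTo? (λ k →
  k ≤? n →-dec 2 ≤? k →-dec k ∸ 1 ≤? length (primesIn (suc n) (k * n))) 7) 21} tt

n+n≤kn : ∀ {n k} → 2 ≤ k → n + n ≤ k * n
n+n≤kn {n} {k} 2≤k = ≤-trans (≤-reflexive (cong (n +_) (sym (+-identityʳ n)))) (*-monoˡ-≤ n 2≤k)

double-cancel-< : ∀ {m n} → m + m < n + n → m < n
double-cancel-< m+m<n+n = ≰⇒> λ n≤m → <⇒≱ m+m<n+n (+-mono-≤ n≤m n≤m)

atLeastPrimes-tiny : ∀ n k → k ≤ n → 2 ≤ k → k * n < 42 → AtLeastPrimes n k
atLeastPrimes-tiny n k k≤n 2≤k kn<42 = primesIn-atLeast (k ∸ 1) (n<1+n n) ≤-refl (tiny n<21 k<7 k≤n 2≤k)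
  where
  n<21 : n < 21
  n<21 = double-cancel-< (≤-<-trans (n+n≤kn 2≤k) kn<42)
  k<7 : k < 7
  k<7 = square-cancel-< (≤-<-trans (*-monoʳ-≤ k k≤n) (<-trans kn<42 (m≤m+n 43 6)))

atLeastPrimes-bands : ∀ n k → k ≤ n → 2 ≤ k → 42 ≤ k * n → k * n < 8192 → AtLeastPrimes n k
atLeastPrimes-bands n k k≤n 2≤k 42≤kn kn<8192
  -- The last cut is 8192, which guarantees that the search ends in a band.
  with find-band 42 cuts cuts-bands 42≤kn (lose {P = k * n <_} (from-yes (8192 ∈? cuts)) kn<8192)
... | a , b , (b≤h+h , b≤r²) , a≤kn , kn<b = primesIn-atLeast (k ∸ 1) n<h a≤kn k∸1≤r
  where
  h = suc b / 2
  n<h : n < h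
  n<h = double-cancel-< (≤-<-trans (n+n≤kn 2≤k) (<-≤-trans kn<b b≤h+h))
  -- The summand 2 in `Band` turns this strict inequality into k - 1 available primes.
  k<2+r : k < 2 + length (primesIn h a)
  k<2+r = square-cancel-< (≤-<-trans (*-monoʳ-≤ k k≤n) (<-≤-trans kn<b b≤r²))
  k∸1≤r : k ∸ 1 ≤ length (primesIn h a)
  k∸1≤r = ∸-monoˡ-≤ 1 (s≤s⁻¹ k<2+r)

-- The range k * n ≥ 8192 and the conclusion

-- Excludes p = k * n, the endpoint left open by p ≤ 2m ≤ k * n when k * n is even.
¬prime-* : ∀ {m n} → 2 ≤ m → 2 ≤ n → ¬ Prime (m * n)
¬prime-* {m} {n} 2≤m 2≤n mn-prime = [ (λ m≡1 → <⇒≢ 2≤m (sym m≡1)) , (λ m≡mn → <⇒≢ m<mn m≡mn) ]′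
  (prime⇒irreducible mn-prime (m∣m*n n))
  where
  m<mn : m < m * n
  m<mn = m<m*n m n {{>-nonZero (<⇒≤ 2≤m)}} 2≤n

atLeastPrimes-large : ∀ n k → k ≤ n → 2 ≤ k → 8192 ≤ k * n → AtLeastPrimes n k
atLeastPrimes-large n k k≤n 2≤k 8192≤kn with halve (k * n)
... | m , kn≡ =
  primesAbove m (suc (m + m)) ,
  Unique.filter⁺ (primeAbove? m) (Unique.downFrom⁺ (suc (m + m))) ,
  All.zipWith in-range (All.all-filter (primeAbove? m) (downFrom (suc (m + m))) ,
    All.filter⁺ (primeAbove? m) {xs = downFrom (suc (m + m))} (All.applyDownFrom⁺₁ id (suc (m + m)) id)) ,
  many-primes-above m k (≤-trans 8192≤kn kn≤M) (≤-trans (*-monoʳ-≤ k k≤n) kn≤M) 2≤k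
  where
  kn≤M : k * n ≤ suc (m + m)
  kn≤M = [ (λ eq → ≤-trans (≤-reflexive eq) (n≤1+n _)) , ≤-reflexive ]′ kn≡
  2m≤kn : m + m ≤ k * n
  2m≤kn = [ ≤-reflexive ∘ sym , (λ eq → ≤-trans (n≤1+n _) (≤-reflexive (sym eq))) ]′ kn≡
  n≤m : n ≤ m
  n≤m = s≤s⁻¹ (double-cancel-< (≤-<-trans (n+n≤kn 2≤k) (≤-<-trans kn≤M (s≤s (+-monoʳ-< m (n<1+n m))))))
  in-range : ∀ {p} → (Prime p × m < p) × p < suc (m + m) → Prime p × n < p × p < k * n
  in-range ((p-prime , m<p) , p≤2m) = p-prime , ≤-<-trans n≤m m<p ,
    ≤∧≢⇒< (≤-trans (s≤s⁻¹ p≤2m) 2m≤kn) λ { refl → ¬prime-* 2≤k (≤-trans 2≤k k≤n) p-prime }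

theorem3p4p1 : ∀ (n k : ℕ) → n ≥ k → k ≥ 2 →
    AtLeast (k ∸ 1) (λ p → Prime p × n < p × p < k * n)
theorem3p4p1 n k n≥k k≥2 with k * n <? 42 | k * n <? 8192
... | yes kn<42 | _           = atLeastPrimes-tiny n k n≥k k≥2 kn<42
... | no  kn≮42 | yes kn<8192 = atLeastPrimes-bands n k n≥k k≥2 (≮⇒≥ kn≮42) kn<8192
... | no  _     | no  kn≮8192 = atLeastPrimes-large n k n≥k k≥2 (≮⇒≥ kn≮8192)
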